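{- Let $a,b,c,d\in\mathbb{Z}$. For any $u\in\mathbb{Z}$ denote $\gamma_u=\frac{cu^4+bu^2+a}{du^3}$. Then $$\mathcal{GP}_{(a,b,c,d)}(\mathbb{Q})=\left\{\left(\pm\gamma_u,\,u\gamma_u,\,\pm u^2\gamma_u\right) : u^2\mid a,\ u>0,\ du^3\mid (cu^4+bu^2+a)\right\}.$$ Furthermore, if $a$ is squarefree and $\gamma=\frac{a+b+c}{d}$, then $$\mathcal{GP}_{(a,b,c,d)}(\mathbb{Q})=\begin{cases}\{(\pm\gamma,\gamma,\pm\gamma)\} & \text{if } d\mid (a+b+c),\\ \emptyset & \text{otherwise.}\end{cases}$$
   Context: $\mathcal{GP}_{(a,b,c,d)}(\mathbb{Q})$ denotes the set of non-trivial triples $(x,y,z)\in\mathbb{Z}^3$ in geometric progression satisfying $ax^2+by^2+cz^2=dxyz$. Here $(x,y,z)$ is in geometric progression over $\mathbb{Z}$ if there exist $\alpha,\beta\in\mathbb{Z}$ with $x=\alpha$, $y=\alpha\beta$, $z=\alpha\beta^2$; the trivial triple, corresponding to $\alpha=0$, is $(0,0,0)$. In a triple such as $(\pm r,s,\pm t)$ the two signs are the same, so it stands for the two triples $(r,s,t)$ and $(-r,s,-t)$.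
   Formalization: Assumes d≠0 (so γ is defined) and, in the first part, a≠0 (for a=0 the triple (1,0,0) is a solution not on the right); the trivial triple (0,0,0) is removed from the right-hand sets, where it occurs when γ_u=0 or γ=0. -}

module Defs where

open import Data.Integer using (ℤ; 0ℤ; 1ℤ; _+_; _*_; -_; _^_; _/_; _>_; NonZero)
open import Data.Integer.Base using (>-nonZero)
open import Data.Integer.Divisibility.Signed using (_∣_)
open import Data.Integer.Properties using (i*j≢0)
open import Data.Nat using (zero; suc)
open import Data.Product using (Σ-syntax; ∃-syntax; _×_; _,_)
open import Level using (0ℓ)
open import Relation.Binary.PropositionalEquality using (_≡_; _≢_)
open import Relation.Unary using (Pred; _∈_; _∪_; ｛_｝)

Triple : Set
Triple = ℤ × ℤ × ℤ

trivial : Triple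
trivial = 0ℤ , 0ℤ , 0ℤ

Equation : (a b c d : ℤ) → Pred Triple 0ℓ
Equation a b c d (x , y , z) =
  a * x ^ 2 + b * y ^ 2 + c * z ^ 2 ≡ d * x * y * z

Geometric : Pred Triple 0ℓ
Geometric (x , y , z) =
  ∃[ α ] ∃[ β ] (x ≡ α × y ≡ α * β × z ≡ α * β ^ 2)

GP : (a b c d : ℤ) → Pred Triple 0ℓ
GP a b c d t = t ≢ trivial × t ∈ Geometric × t ∈ Equation a b c d

-- The two triples abbreviated (± r , s , ± t), the signs being equal.
± : (r s t : ℤ) → Pred Triple 0ℓ
± r s t = ｛ r , s , t ｝ ∪ ｛ - r , s , - t ｝

-- Zero is not squarefree: every k satisfies k ^ 2 ∣ 0.
Squarefree : Pred ℤ 0ℓ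
Squarefree a = ∀ k → k ^ 2 ∣ a → k ∣ 1ℤ

γ-numerator : (a b c u : ℤ) → ℤ
γ-numerator a b c u = c * u ^ 4 + b * u ^ 2 + a

γ-denominator : (d u : ℤ) → ℤ
γ-denominator d u = d * u ^ 3

^-nonZero : ∀ u .{{_ : NonZero u}} n → NonZero (u ^ n)
^-nonZero u zero    = _
^-nonZero u (suc n) = i*j≢0 u (u ^ n)
  where instance _ = ^-nonZero u n

γ-denominator≢0 : ∀ d u .{{_ : NonZero d}} .{{_ : NonZero u}} →
                  NonZero (γ-denominator d u)
γ-denominator≢0 d u = i*j≢0 d (u ^ 3)
  where instance _ = ^-nonZero u 3

-- Integer division, which agrees with the rational quotient exactly when the
-- denominator divides the numerator; γ is only used under that condition.
γ : (a b c d u : ℤ) .{{_ : NonZero d}} .{{u≢0 : NonZero u}} → ℤ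
γ a b c d u =
  (γ-numerator a b c u / γ-denominator d u) {{γ-denominator≢0 d u}}

-- The union, over all admissible u, of {(± γ_u , u γ_u , ± u² γ_u)}.
Family : (a b c d : ℤ) .{{_ : NonZero d}} → Pred Triple 0ℓ
Family a b c d t =
  ∃[ u ] Σ[ u>0 ∈ u > 0ℤ ]
    let γᵤ = γ a b c d u {{u≢0 = >-nonZero u>0}} in
    u ^ 2 ∣ a ×
    γ-denominator d u ∣ γ-numerator a b c u ×
    t ∈ ± γᵤ (u * γᵤ) (u ^ 2 * γᵤ)

{-# OPTIONS --safe #-}
module Submission where

-- A nontrivial geometric triple has the form (α , α β , α β²) with α ≠ 0, and
-- on it the equation is α² times
--
--   c β⁴ + b β² + a = α · (d β³).
--
-- Cancelling α² therefore leaves a relation that is linear in α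
-- (equation⇒reduced), which says that α = γ_β. If a ≠ 0, then β ≠ 0,
-- because β = 0 would reduce the relation to a = 0. The relation is invariant
-- under (α , β) ↦ (- α , - β), a change that fixes the middle entry of the
-- triple and negates the outer two; so β can be replaced by u = ∣β∣ at the
-- price of the sign ± (GP⇒Parametrised). Every term of the relation other than
-- a is a multiple of u², hence u² ∣ a (u²∣a).
-- Conversely, the relation implies the equation, so every nontrivial triple
-- (± r , u r , ± u² r) with r = γ_u is a solution (Parametrised⇒GP).
--
-- If a is squarefree, then a ≠ 0, and u² ∣ a forces u = 1. The relation becomes
-- a + b + c = α · d, which is solvable exactly when d ∣ a + b + c, and then
-- only by α = γ₀.

open import Defs
open import Data.Integer
  using (ℤ; 0ℤ; 1ℤ; +_; +0; +[1+_]; -[1+_]; _+_; _*_; -_; _^_; _/_; _%_; _>_;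
         +<+; NonZero)
open import Data.Integer.Base using (>-nonZero; ≢-nonZero)
open import Data.Integer.DivMod using (a≡a%n+[a/n]*n; n%d<d)
open import Data.Integer.Divisibility.Signed
  using (_∣_; divides; ∣⇒∣ᵤ; ∣m+n∣m⇒∣n; ∣m+n∣n⇒∣m; 0∣⇒≡0)
open import Data.Integer.Properties
  using (*-cancelˡ-≡; *-cancelʳ-≡; *-comm; *-identityˡ; *-identityʳ; +-identityˡ;
         neg-involutive)
open import Data.Integer.Solver using (module +-*-Solver)
import Data.Nat as ℕ
import Data.Nat.Divisibility as ℕ
open import Data.Product using (∃-syntax; _×_; _,_)
open import Data.Sum using (inj₁; inj₂)
open import Function using (_∘_)
open import Level using (0ℓ)
open import Relation.Binary.PropositionalEquality
  using (_≡_; _≢_; refl; sym; trans; cong; cong₂; subst)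
open import Relation.Nullary using (¬_; contradiction)
open import Relation.Unary using (Pred; _∈_; _⊆_; _≐_; _∖_; ｛_｝; ∅)

open +-*-Solver using (solve; _:=_; _:+_; _:*_; :-_; _:^_; con)

-- The remainder is a multiple of d that is smaller than ∣d∣, hence zero.
∣⇒n≡[n/d]*d : ∀ {n} d .{{_ : NonZero d}} → d ∣ n → n ≡ (n / d) * d
∣⇒n≡[n/d]*d {n} d d∣n = trans division
  (trans (cong (λ r → + r + (n / d) * d) (remainder≡0 (∣⇒∣ᵤ d∣remainder) (n%d<d n d)))
         (+-identityˡ _))
  where
  division : n ≡ + (n % d) + (n / d) * d
  division = a≡a%n+[a/n]*n n d

  d∣remainder : d ∣ + (n % d)
  d∣remainder = ∣m+n∣n⇒∣m (subst (d ∣_) division d∣n) (divides (n / d) refl)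

  remainder≡0 : ∀ {k r} → k ℕ.∣ r → r ℕ.< k → r ≡ 0
  remainder≡0 {r = ℕ.zero}  _   _   = refl
  remainder≡0 {r = ℕ.suc _} k∣r r<k = contradiction k∣r (ℕ.>⇒∤ r<k)

≡q*d⇒/≡q : ∀ {n q} d .{{_ : NonZero d}} → n ≡ q * d → n / d ≡ q
≡q*d⇒/≡q {n} {q} d n≡qd =
  *-cancelʳ-≡ (n / d) q d (trans (sym (∣⇒n≡[n/d]*d d (divides q n≡qd))) n≡qd)

>0∧∣1⇒≡1 : ∀ {u} → u > 0ℤ → u ∣ 1ℤ → u ≡ 1ℤ
>0∧∣1⇒≡1 {+ n} _ u∣1 = cong +_ (ℕ.∣1⇒≡1 (∣⇒∣ᵤ u∣1))

squarefree⇒≢0 : ∀ {a} → Squarefree a → a ≢ 0ℤ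
squarefree⇒≢0 squarefree refl
  with () ← 0∣⇒≡0 (squarefree 0ℤ (divides 0ℤ refl))

module _ (a b c d : ℤ) where

  -- The pairs (α , β) on which the equation, taken at (α , α β , α β²) and
  -- divided by α², holds. For β ≠ 0 and d ≠ 0 this says that γ_β is the integer
  -- α.
  Reduced : ℤ → ℤ → Set
  Reduced α β = γ-numerator a b c β ≡ α * γ-denominator d β

  equation-lhs : ∀ α β →
    a * α ^ 2 + b * (α * β) ^ 2 + c * (α * β ^ 2) ^ 2 ≡ α ^ 2 * γ-numerator a b c β
  equation-lhs = solve 5
    (λ a b c α β →
      a :* α :^ 2 :+ b :* (α :* β) :^ 2 :+ c :* (α :* β :^ 2) :^ 2 :=
      α :^ 2 :* (c :* β :^ 4 :+ b :* β :^ 2 :+ a))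
    refl a b c

  equation-rhs : ∀ α β →
    d * α * (α * β) * (α * β ^ 2) ≡ α ^ 2 * (α * γ-denominator d β)
  equation-rhs = solve 3
    (λ d α β →
      d :* α :* (α :* β) :* (α :* β :^ 2) := α :^ 2 :* (α :* (d :* β :^ 3)))
    refl d

  equation⇒reduced : ∀ α β → α ≢ 0ℤ →
    (α , α * β , α * β ^ 2) ∈ Equation a b c d → Reduced α β
  equation⇒reduced α β α≢0 eq = *-cancelˡ-≡ (α ^ 2) _ _
    {{^-nonZero α {{≢-nonZero α≢0}} 2}}
    (trans (sym (equation-lhs α β)) (trans eq (equation-rhs α β)))

  reduced⇒equation : ∀ α β → Reduced α β →
    (α , α * β , α * β ^ 2) ∈ Equation a b c d
  reduced⇒equation α β red =
    trans (equation-lhs α β) (trans (cong (α ^ 2 *_) red) (sym (equation-rhs α β)))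

  -- The numerator of γ is even in β and the denominator odd.
  reduced-neg : ∀ α β → Reduced α β → Reduced (- α) (- β)
  reduced-neg α β red = trans (numerator-even b c β a) (trans red (denominator-odd α d β))
    where
    numerator-even : ∀ b c β a →
      c * (- β) ^ 4 + b * (- β) ^ 2 + a ≡ c * β ^ 4 + b * β ^ 2 + a
    numerator-even = solve 4
      (λ b c β a →
        c :* (:- β) :^ 4 :+ b :* (:- β) :^ 2 :+ a := c :* β :^ 4 :+ b :* β :^ 2 :+ a)
      refl

    denominator-odd : ∀ α d β → α * (d * β ^ 3) ≡ - α * (d * (- β) ^ 3)
    denominator-odd = solve 3
      (λ α d β → α :* (d :* β :^ 3) := (:- α) :* (d :* (:- β) :^ 3))
      refl

  reduced-at-0 : ∀ α → Reduced α 0ℤ → a ≡ 0ℤ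
  reduced-at-0 α red = trans (sym (numerator c b a)) (trans red (denominator α d))
    where
    numerator : ∀ c b a → c * 0ℤ ^ 4 + b * 0ℤ ^ 2 + a ≡ a
    numerator = solve 3
      (λ c b a → c :* con 0ℤ :^ 4 :+ b :* con 0ℤ :^ 2 :+ a := a) refl

    denominator : ∀ α d → α * (d * 0ℤ ^ 3) ≡ 0ℤ
    denominator = solve 2 (λ α d → α :* (d :* con 0ℤ :^ 3) := con 0ℤ) refl

  numerator-at-1 : γ-numerator a b c 1ℤ ≡ a + b + c
  numerator-at-1 = solve 3
    (λ a b c → c :* con 1ℤ :^ 4 :+ b :* con 1ℤ :^ 2 :+ a := a :+ b :+ c) refl a b c

  denominator-at-1 : γ-denominator d 1ℤ ≡ d
  denominator-at-1 = *-identityʳ d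

  u²∣a : ∀ α u → Reduced α u → u ^ 2 ∣ a
  u²∣a α u red = ∣m+n∣m⇒∣n
    (divides (α * d * u) (trans red (denominator α d u)))
    (divides (c * u ^ 2 + b) (numerator c b u))
    where
    denominator : ∀ α d u → α * (d * u ^ 3) ≡ α * d * u * u ^ 2
    denominator = solve 3
      (λ α d u → α :* (d :* u :^ 3) := α :* d :* u :* u :^ 2) refl

    numerator : ∀ c b u → c * u ^ 4 + b * u ^ 2 ≡ (c * u ^ 2 + b) * u ^ 2
    numerator = solve 3
      (λ c b u → c :* u :^ 4 :+ b :* u :^ 2 := (c :* u :^ 2 :+ b) :* u :^ 2) refl

  -- The triples (± r , u r , ± u² r) with u > 0 and r = γ_u, the latter stated
  -- without division.
  Parametrised : Pred Triple 0ℓ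
  Parametrised t =
    ∃[ u ] ∃[ r ] (u > 0ℤ × Reduced r u × t ∈ ± r (u * r) (u ^ 2 * r))

  triple⁺ : ∀ r u → (r , r * u , r * u ^ 2) ≡ (r , u * r , u ^ 2 * r)
  triple⁺ r u = cong₂ (λ y z → r , y , z) (*-comm r u) (*-comm r (u ^ 2))

  -- Negating both parameters gives the second triple of ±.
  triple⁻ : ∀ r u →
    (- r , - r * - u , - r * (- u) ^ 2) ≡ (- r , u * r , - (u ^ 2 * r))
  triple⁻ r u = cong₂ (λ y z → - r , y , z)
    (solve 2 (λ r u → (:- r) :* (:- u) := u :* r) refl r u)
    (solve 2 (λ r u → (:- r) :* (:- u) :^ 2 := :- (u :^ 2 :* r)) refl r u)

  GP⇒Parametrised : a ≢ 0ℤ → GP a b c d ⊆ Parametrised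
  GP⇒Parametrised a≢0 (t≢trivial , (α , β , refl , refl , refl) , eq) =
    parametrise β (equation⇒reduced α β α≢0 eq)
    where
    -- Products with left factor 0ℤ compute to 0ℤ.
    α≢0 : α ≢ 0ℤ
    α≢0 = t≢trivial ∘ cong (λ x → x , x * β , x * β ^ 2)

    parametrise : ∀ β → Reduced α β → Parametrised (α , α * β , α * β ^ 2)
    parametrise +0 red = contradiction (reduced-at-0 α red) a≢0
    parametrise u@(+[1+ _ ]) red =
      u , α , +<+ ℕ.z<s , red , inj₁ (sym (triple⁺ α u))
    parametrise β@(-[1+ _ ]) red =
      - β , - α , +<+ ℕ.z<s , reduced-neg α β red ,
      inj₂ (trans (sym (triple⁻ (- α) (- β)))
                  (cong (λ x → x , x * β , x * β ^ 2) (neg-involutive α)))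

  Parametrised⇒GP : Parametrised ∖ ｛ trivial ｝ ⊆ GP a b c d
  Parametrised⇒GP ((u , r , _ , red , t∈±) , t∉trivial) = t∉trivial ∘ sym , solution t∈±
    where
    reduced⇒solution : ∀ α β {t} → Reduced α β → (α , α * β , α * β ^ 2) ≡ t →
      t ∈ Geometric × t ∈ Equation a b c d
    reduced⇒solution α β red refl = (α , β , refl , refl , refl) , reduced⇒equation α β red

    solution : ∀ {t} → t ∈ ± r (u * r) (u ^ 2 * r) →
      t ∈ Geometric × t ∈ Equation a b c d
    solution (inj₁ eq) = reduced⇒solution r u red (trans (triple⁺ r u) eq)
    solution (inj₂ eq) =
      reduced⇒solution (- r) (- u) (reduced-neg r u red) (trans (triple⁻ r u) eq)

  -- Here u² ∣ a leaves only u = 1.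
  Parametrised⇒quotient : Squarefree a → ∀ {t} → t ∈ Parametrised →
    ∃[ r ] (a + b + c ≡ r * d × t ∈ ± r r r)
  Parametrised⇒quotient squarefree {t} (u , r , u>0 , red , t∈±) =
    r ,
    trans (sym numerator-at-1)
      (trans (subst (Reduced r) u≡1 red) (cong (r *_) denominator-at-1)) ,
    subst (λ x → t ∈ ± r x x) (*-identityˡ r)
      (subst (λ u → t ∈ ± r (u * r) (u ^ 2 * r)) u≡1 t∈±)
    where
    u≡1 : u ≡ 1ℤ
    u≡1 = >0∧∣1⇒≡1 u>0 (squarefree u (u²∣a r u red))

  quotient⇒Parametrised : ∀ {r} → a + b + c ≡ r * d → ± r r r ⊆ Parametrised
  quotient⇒Parametrised {r} eq {t} t∈± =
    1ℤ , r , +<+ ℕ.z<s ,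
    trans numerator-at-1 (trans eq (cong (r *_) (sym denominator-at-1))) ,
    subst (λ x → t ∈ ± r x x) (sym (*-identityˡ r)) t∈±

  module _ .{{_ : NonZero d}} where

    Parametrised⇒Family : Parametrised ⊆ Family a b c d
    Parametrised⇒Family {t} (u , r , u>0 , red , t∈±) =
      u , u>0 , u²∣a r u red , divides r red ,
      subst (λ r → t ∈ ± r (u * r) (u ^ 2 * r)) (sym (≡q*d⇒/≡q _ red)) t∈±
      where
      instance
        u≢0 = >-nonZero u>0
        den≢0 = γ-denominator≢0 d u

    Family⇒Parametrised : Family a b c d ⊆ Parametrised
    Family⇒Parametrised (u , u>0 , _ , den∣num , t∈±) =
      u , γ a b c d u , u>0 , ∣⇒n≡[n/d]*d (γ-denominator d u) den∣num , t∈±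
      where
      instance
        u≢0 = >-nonZero u>0
        den≢0 = γ-denominator≢0 d u

theorem4p3 : (a b c d : ℤ) .{{_ : NonZero d}} →
    (a ≢ 0ℤ → GP a b c d ≐ Family a b c d ∖ ｛ trivial ｝)
    × (Squarefree a → let γ₀ = (a + b + c) / d in
    (d ∣ a + b + c → GP a b c d ≐ ± γ₀ γ₀ γ₀ ∖ ｛ trivial ｝)
    × (¬ (d ∣ a + b + c) → GP a b c d ≐ ∅))
theorem4p3 a b c d = general , λ squarefree →
  divisible squarefree , indivisible squarefree
  where
  GP⇒∉trivial : ∀ {t} → t ∈ GP a b c d → ¬ (trivial ≡ t)
  GP⇒∉trivial (t≢trivial , _) = t≢trivial ∘ sym

  general : a ≢ 0ℤ → GP a b c d ≐ Family a b c d ∖ ｛ trivial ｝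
  general a≢0 =
    (λ t∈GP → Parametrised⇒Family a b c d (GP⇒Parametrised a b c d a≢0 t∈GP) ,
              GP⇒∉trivial t∈GP) ,
    (λ (t∈Family , t∉trivial) →
      Parametrised⇒GP a b c d (Family⇒Parametrised a b c d t∈Family , t∉trivial))

  GP⇒quotient : Squarefree a → ∀ {t} → t ∈ GP a b c d →
    ∃[ r ] (a + b + c ≡ r * d × t ∈ ± r r r)
  GP⇒quotient squarefree =
    Parametrised⇒quotient a b c d squarefree ∘
    GP⇒Parametrised a b c d (squarefree⇒≢0 squarefree)

  divisible : Squarefree a → let γ₀ = (a + b + c) / d in
    d ∣ a + b + c → GP a b c d ≐ ± γ₀ γ₀ γ₀ ∖ ｛ trivial ｝
  divisible squarefree d∣a+b+c =
    (λ {t} t∈GP → let r , eq , t∈± = GP⇒quotient squarefree t∈GP in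
      subst (λ r → t ∈ ± r r r) (sym (≡q*d⇒/≡q d eq)) t∈± , GP⇒∉trivial t∈GP) ,
    (λ (t∈± , t∉trivial) →
      Parametrised⇒GP a b c d
        (quotient⇒Parametrised a b c d (∣⇒n≡[n/d]*d d d∣a+b+c) t∈± , t∉trivial))

  indivisible : Squarefree a → ¬ (d ∣ a + b + c) → GP a b c d ≐ ∅
  indivisible squarefree d∤a+b+c =
    (λ t∈GP → let r , eq , _ = GP⇒quotient squarefree t∈GP in
      d∤a+b+c (divides r eq)) ,
    λ ()
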